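{- Let $n\ge 1$ be an integer and let $G$ be any (finite, simple) graph. Let $M_1,\ldots,M_{3n-2}$ be matchings in $G$ (not necessarily distinct), each of size $n$. Then there is a rainbow matching of size $n$ for the family $(M_1,\ldots,M_{3n-2})$; that is, there are $n$ pairwise disjoint edges $e_1,\ldots,e_n$ of $G$ and distinct indices $i_1,\ldots,i_n\in\{1,\ldots,3n-2\}$ with $e_j\in M_{i_j}$ for every $j$.
   Context: Given a system $(C_1,\ldots,C_m)$ of sets of edges in a graph, a rainbow matching for it is a matching each of whose edges is chosen from a different $C_i$ (not all $C_i$ need be represented). -}

module Defs where

open import Data.Nat using (ℕ)
open import Data.Fin using (Fin)
open import Data.Empty using (⊥)
open import Data.Product using (Σ; ∃; _×_; _,_)
open import Data.Sum using (_⊎_)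
open import Relation.Binary.PropositionalEquality using (_≡_; _≢_)
open import Function.Definitions using (Injective)

record Graph (V : ℕ) : Set₁ where
  field
    Adj    : Fin V → Fin V → Set
    sym    : ∀ {x y} → Adj x y → Adj y x
    irrefl : ∀ {x} → Adj x x → ⊥

open Graph public

record Edge {V : ℕ} (G : Graph V) : Set where
  constructor edge
  field
    end₁ : Fin V
    end₂ : Fin V
    adj  : Adj G end₁ end₂

open Edge public

SameEdge : ∀ {V} {G : Graph V} → Edge G → Edge G → Set
SameEdge e f = (end₁ e ≡ end₁ f × end₂ e ≡ end₂ f)
             ⊎ (end₁ e ≡ end₂ f × end₂ e ≡ end₁ f)

_∈ᵥ_ : ∀ {V} {G : Graph V} → Fin V → Edge G → Set
x ∈ᵥ e = (x ≡ end₁ e) ⊎ (x ≡ end₂ e)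

Disjoint : ∀ {V} {G : Graph V} → Edge G → Edge G → Set
Disjoint e f = ∀ x → x ∈ᵥ e → x ∈ᵥ f → ⊥

PairwiseDisjoint : ∀ {V} {G : Graph V} {k : ℕ} → (Fin k → Edge G) → Set
PairwiseDisjoint {k = k} es = ∀ (i j : Fin k) → i ≢ j → Disjoint (es i) (es j)

-- A matching of size k in G: k pairwise disjoint edges
-- (pairwise disjointness forces them to be k distinct edges).
record Matching {V : ℕ} (G : Graph V) (k : ℕ) : Set where
  field
    edges    : Fin k → Edge G
    disjoint : PairwiseDisjoint edges

open Matching public

_∈ₘ_ : ∀ {V} {G : Graph V} {k} → Edge G → Matching G k → Set
e ∈ₘ M = ∃ λ i → SameEdge e (edges M i)

RainbowMatching : ∀ {V} {G : Graph V} {m k : ℕ} →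
                  (Fin m → Matching G k) → (n : ℕ) → Set
RainbowMatching {G = G} {m = m} Ms n =
  Σ (Fin n → Edge G) λ es →
  Σ (Fin n → Fin m) λ idx →
    PairwiseDisjoint es × Injective _≡_ _≡_ idx × (∀ j → es j ∈ₘ Ms (idx j))

{-# OPTIONS --safe #-}
module Submission where

-- Start from a rainbow matching of size k < n and the graph H formed by its edges, and add edges of
-- unused colours one at a time. As long as H has no matching of size k + 1, let D(H) be the set of
-- vertices missed by some matching of size k in H. Every matching M of size k + 1 contains an edge whose
-- addition to H either creates a matching of size k + 1 or enlarges D(H): otherwise delete vertices
-- outside D(H) with a neighbour in D(H), which does not enlarge D(H), until no edge leaves D(H); then
-- Gallai's equivalence relation (no maximum matching misses both vertices) shows that M has at most k
-- edges. Initially at most 2k vertices lie outside D(H), so k + 2k < 3n - 2 colours in all suffice to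
-- reach a rainbow matching of size k + 1.

open import Defs
open import Data.Empty using (⊥-elim)
open import Data.Fin using (Fin; zero; suc; inject≤)
open import Data.Fin.Properties using (_≟_; any?; suc-injective; injective⇒≤; inject≤-injective)
open import Data.List using (List; []; _∷_; length; map)
import Data.List.Membership.DecPropositional
open import Data.List.Membership.Propositional using (_∈_; _∉_; find)
open import Data.List.Membership.Propositional.Properties using (∈-map⁺)
open import Data.List.Membership.Setoid.Properties using (index-injective)
open import Data.List.Properties using (length-map; length-removeAt′)
open import Data.List.Relation.Binary.Permutation.Propositional
  using (_↭_; swap; prep; ↭-refl; ↭-sym; ↭-trans)
open import Data.List.Relation.Binary.Permutation.Propositional.Properties
  using (∈-resp-↭; shifts)
open import Data.List.Relation.Binary.Subset.Propositional using (_⊆_)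
open import Data.List.Relation.Unary.Any as Any using (Any; here; there; index; _─_)
open import Data.Nat using (ℕ; zero; suc; pred; _+_; _≥_; _∸_; _*_; _≤_; _<_; s≤s)
open import Data.Nat.Properties
  using (n<1+n; +-suc; *-suc; *-monoʳ-≤; m≤m+n; ≤-refl; ≤-reflexive; ≤-trans; ≤-<-trans; <⇒≤; <⇒≱)
open import Data.Product using (∃; ∃₂; _×_; _,_; proj₁; proj₂)
open import Data.Sum using (_⊎_; inj₁; inj₂)
import Data.Sum as Sum
open import Data.Unit using (tt)
open import Function using (_∘_; id)
open import Level using (0ℓ)
open import Relation.Binary using (Rel; Symmetric; Transitive) renaming (Decidable to Decidable₂)
open import Relation.Binary.PropositionalEquality
  using (_≡_; _≢_; refl; cong; cong₂; trans; subst; setoid; ≢-sym) renaming (sym to ≡-sym)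
open import Relation.Nullary using (¬_; Dec; yes; no)
open import Relation.Nullary.Decidable using (map′; ¬?; _×-dec_; _⊎-dec_)
open import Relation.Unary using (Pred; Decidable)

private
  variable
    V k l : ℕ
    H H′ E : Rel (Fin V) 0ℓ
    a u v w : Fin V
    xs ys : List (Fin V)

open module DecMembership {V} = Data.List.Membership.DecPropositional (_≟_ {V}) using (_∈?_)

∉-∷ : ∀ {A : Set} {x y : A} {zs} → x ≢ y → x ∉ zs → x ∉ y ∷ zs
∉-∷ x≢y x∉zs (here x≡y)   = x≢y x≡y
∉-∷ x≢y x∉zs (there x∈zs) = x∉zs x∈zs

-- Matchings in a relation on a finite vertex set

-- The list xs enumerates the covered vertices, edge by edge.
data Match (H : Rel (Fin V) 0ℓ) : ℕ → List (Fin V) → Set where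
  []  : Match H 0 []
  add : u ≢ v → H u v → u ∉ xs → v ∉ xs → Match H k xs → Match H (suc k) (u ∷ v ∷ xs)

mapMatch : (∀ {u v} → u ∈ xs → v ∈ xs → H u v → H′ u v) → Match H k xs → Match H′ k xs
mapMatch f []                  = []
mapMatch f (add n h u∉ v∉ m) =
  add n (f (here refl) (there (here refl)) h) u∉ v∉ (mapMatch (λ p q → f (there (there p)) (there (there q))) m)

-- Exhaustive search over the end points. It makes the later case distinctions, such as whether a
-- vertex is missable, constructive.
match? : Decidable₂ H → {P : Pred (List (Fin V)) 0ℓ} → Decidable P →
         ∀ k → Dec (∃ λ xs → Match H k xs × P xs)
match? H? P? zero    = map′ (λ p → [] , [] , p) (λ { (_ , [] , p) → p }) (P? [])
match? H? P? (suc k) =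
  map′ (λ { (u , v , xs , m , n , h , u∉ , v∉ , p) → u ∷ v ∷ xs , add n h u∉ v∉ m , p })
       (λ { (_ , add n h u∉ v∉ m , p) → _ , _ , _ , m , n , h , u∉ , v∉ , p })
       (any? λ u → any? λ v → match? H? (λ xs →
          ¬? (u ≟ v) ×-dec H? u v ×-dec ¬? (u ∈? xs) ×-dec ¬? (v ∈? xs) ×-dec P? (u ∷ v ∷ xs)) k)

-- Alternating paths

data Split (H : Rel (Fin V) 0ℓ) (a : Fin V) : ℕ → List (Fin V) → Set where
  split : ∀ {b} → a ≢ b → H a b → a ∉ ys → b ∉ ys → Match H k ys →
          xs ↭ a ∷ b ∷ ys → Split H a (suc k) xs

splitAt : Symmetric H → a ∈ xs → Match H k xs → Split H a k xs
splitAt sym (here refl)         (add n h u∉ v∉ m) = split n h u∉ v∉ m ↭-refl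
splitAt sym (there (here refl)) (add n h u∉ v∉ m) =
  split (≢-sym n) (sym h) v∉ u∉ m (swap _ _ ↭-refl)
splitAt {a = a} sym (there (there a∈)) (add {u} {v} n h u∉ v∉ m) with splitAt sym a∈ m
... | split {ys} {b = b} n′ h′ a∉ b∉ m′ π =
  split n′ h′
    (∉-∷ (λ { refl → u∉ a∈ }) (∉-∷ (λ { refl → v∉ a∈ }) a∉))
    (∉-∷ (λ { refl → u∉ (back (there (here refl))) }) (∉-∷ (λ { refl → v∉ (back (there (here refl))) }) b∉))
    (add n h (u∉ ∘ back ∘ there ∘ there) (v∉ ∘ back ∘ there ∘ there) m′)
    (↭-trans (prep u (prep v π)) (shifts (u ∷ v ∷ []) (a ∷ b ∷ [])))
  where
  back : a ∷ b ∷ ys ⊆ _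
  back = ∈-resp-↭ (↭-sym π)

-- The alternating path from a, covered by the second matching only, ends at a vertex x which is also
-- covered by exactly one of the two matchings; swapping along the path yields new matchings.
data Exchange (H : Rel (Fin V) 0ℓ) (a : Fin V) (k : ℕ) (xs : List (Fin V)) :
              ℕ → List (Fin V) → Set where
  augment : ∀ {x xs′ ys′} → x ∈ ys → x ∉ xs → x ≢ a →
            Match H (suc k) xs′ → xs′ ⊆ a ∷ x ∷ xs →
            Match H l ys′ → ys′ ⊆ ys → a ∉ ys′ → x ∉ ys′ →
            Exchange H a k xs (suc l) ys
  slide   : ∀ {x ys′} → x ∈ xs → Match H l ys′ → ys′ ⊆ x ∷ ys → a ∉ ys′ →
            Exchange H a k xs l ys

-- The path is followed two edges at a time: `a b` in `N`, then `b c` in `Q`. It ends at `b` if `Q`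
-- misses `b`, and at `c` if `N` misses `c`; otherwise it continues from `c` with both edges
-- removed.
exchange : Symmetric H → Match H k xs → Match H l ys → a ∉ xs → a ∈ ys → Exchange H a k xs l ys
exchange {H = H} {xs = xs} {l = l} {ys = ys} {a = a} sym Q N a∉xs a∈ys with splitAt sym a∈ys N
... | split {ys₁} {b = b} a≢b ab a∉ys₁ b∉ys₁ N₁ π with b ∈? xs
...   | no b∉xs =
        augment (back (there (here refl))) b∉xs (≢-sym a≢b) (add a≢b ab a∉xs b∉xs Q) id
                N₁ (back ∘ there ∘ there) a∉ys₁ b∉ys₁
  where
  back : a ∷ b ∷ ys₁ ⊆ ys
  back = ∈-resp-↭ (↭-sym π)
...   | yes b∈xs with splitAt sym b∈xs Q
...     | split {xs₁} {b = c} b≢c bc b∉xs₁ c∉xs₁ Q₁ ρ with c ∈? ys₁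
...       | no c∉ys₁ =
            slide c∈xs (add b≢c bc b∉ys₁ c∉ys₁ N₁)
              (λ { (here refl) → there (back (there (here refl)))
                 ; (there (here refl)) → here refl
                 ; (there (there p)) → there (back (there (there p))) })
              (∉-∷ a≢b (∉-∷ (λ { refl → a∉xs c∈xs }) a∉ys₁))
  where
  back : a ∷ b ∷ ys₁ ⊆ ys
  back = ∈-resp-↭ (↭-sym π)
  c∈xs : c ∈ xs
  c∈xs = ∈-resp-↭ (↭-sym ρ) (there (here refl))
...       | yes c∈ys₁ = result (exchange sym Q₁ N₁ c∉xs₁ c∈ys₁)
  where
  back : a ∷ b ∷ ys₁ ⊆ ys
  back = ∈-resp-↭ (↭-sym π)
  backₓ : b ∷ c ∷ xs₁ ⊆ xs
  backₓ = ∈-resp-↭ (↭-sym ρ)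
  a≢c : a ≢ c
  a≢c refl = a∉xs (backₓ (there (here refl)))
  result : ∀ {k l} → Exchange H c k xs₁ l ys₁ → Exchange H a (suc k) xs (suc l) ys
  result (augment {x = x} {xs′} {ys′} x∈ x∉ x≢c Q₂ ⊆Q N₂ ⊆N c∉ x∉′) =
    augment (back (there (there x∈))) x∉xs (λ { refl → a∉ys₁ x∈ })
      (add a≢b ab a∉xs′ b∉xs′ Q₂) ⊆Q′
      (add b≢c bc (b∉ys₁ ∘ ⊆N) c∉ N₂)
      (λ { (here refl) → back (there (here refl))
         ; (there (here refl)) → back (there (there c∈ys₁))
         ; (there (there p)) → back (there (there (⊆N p))) })
      (∉-∷ a≢b (∉-∷ a≢c (a∉ys₁ ∘ ⊆N)))
      (∉-∷ x≢b (∉-∷ x≢c x∉′))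
    where
    x≢b : x ≢ b
    x≢b refl = b∉ys₁ x∈
    x∉xs : x ∉ xs
    x∉xs = ∉-∷ x≢b (∉-∷ x≢c x∉) ∘ ∈-resp-↭ ρ
    a∉xs′ : a ∉ xs′
    a∉xs′ = ∉-∷ a≢c (∉-∷ (λ { refl → a∉ys₁ x∈ }) (a∉xs ∘ backₓ ∘ there ∘ there)) ∘ ⊆Q
    b∉xs′ : b ∉ xs′
    b∉xs′ = ∉-∷ b≢c (∉-∷ (≢-sym x≢b) b∉xs₁) ∘ ⊆Q
    ⊆Q′ : a ∷ b ∷ xs′ ⊆ a ∷ x ∷ xs
    ⊆Q′ (here refl)         = here refl
    ⊆Q′ (there (here refl)) = there (there b∈xs)
    ⊆Q′ (there (there p)) with ⊆Q p
    ... | here refl         = there (there (backₓ (there (here refl))))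
    ... | there (here refl) = there (here refl)
    ... | there (there q)   = there (there (backₓ (there (there q))))
  result (slide {x = x} x∈ N₂ ⊆N c∉) =
    slide (backₓ (there (there x∈)))
      (add b≢c bc (∉-∷ (λ { refl → b∉xs₁ x∈ }) b∉ys₁ ∘ ⊆N) c∉ N₂)
      (λ { (here refl) → there (back (there (here refl)))
         ; (there (here refl)) → there (back (there (there c∈ys₁)))
         ; (there (there p)) → ⊆N′ (⊆N p) })
      (∉-∷ a≢b (∉-∷ a≢c (∉-∷ (λ { refl → a∉xs (backₓ (there (there x∈))) }) a∉ys₁ ∘ ⊆N)))
    where
    ⊆N′ : x ∷ ys₁ ⊆ x ∷ ys
    ⊆N′ (here refl) = here refl
    ⊆N′ (there p)   = there (back (there (there p)))

-- Comparing two matchings inside an equivalence relation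

UnmatchedPair : Rel (Fin V) 0ℓ → List (Fin V) → List (Fin V) → Set
UnmatchedPair R ys xs = ∃₂ λ p q → p ≢ q × R p q × (p ∈ ys × p ∉ xs) × (q ∈ ys × q ∉ xs)

-- Dropping the edge `b c` leaves `c` uncovered, so `c` may occur in the pair found; `a` then takes
-- its place, being related to `c` through `b`.
contractPath : ∀ {R : Rel (Fin V) 0ℓ} {a b c xs ys ys′ zs} → Symmetric R → Transitive R →
               R a b → R b c → a ∉ ys → b ∉ ys → a ∉ xs → a ∈ ys′ → ys ⊆ ys′ → xs ↭ b ∷ c ∷ zs →
               UnmatchedPair R ys zs → UnmatchedPair R ys′ xs
contractPath {c = c} {xs} {ys} {zs = zs} sym tr ab bc a∉ys b∉ys a∉xs a∈ys′ ys⊆ π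
             (p , q , p≢q , pq , (p∈ , p∉) , (q∈ , q∉)) = result (p ≟ c) (q ≟ c)
  where
  ∉xs : ∀ {r} → r ∈ ys → r ≢ c → r ∉ zs → r ∉ xs
  ∉xs r∈ r≢c r∉ = ∉-∷ (λ { refl → b∉ys r∈ }) (∉-∷ r≢c r∉) ∘ ∈-resp-↭ π
  result : Dec (p ≡ c) → Dec (q ≡ c) → UnmatchedPair _ _ xs
  result (yes refl) (yes refl) = ⊥-elim (p≢q refl)
  result (yes refl) (no q≢c)   =
    _ , q , (λ { refl → a∉ys q∈ }) , tr ab (tr bc pq) , (a∈ys′ , a∉xs) , (ys⊆ q∈ , ∉xs q∈ q≢c q∉)
  result (no p≢c)   (yes refl) =
    p , _ , (λ { refl → a∉ys p∈ }) , tr pq (sym (tr ab bc)) , (ys⊆ p∈ , ∉xs p∈ p≢c p∉) , (a∈ys′ , a∉xs)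
  result (no p≢c)   (no q≢c)   =
    p , q , p≢q , pq , (ys⊆ p∈ , ∉xs p∈ p≢c p∉) , (ys⊆ q∈ , ∉xs q∈ q≢c q∉)

-- Induction on the larger matching: one of its edges is contracted, together with the edges of the
-- smaller matching that meet it.
unmatchedPair : {R : Rel (Fin V) 0ℓ} → Symmetric R → Transitive R →
                Match R l ys → Match R k xs → k < l → UnmatchedPair R ys xs
unmatchedPair sym tr [] N ()
unmatchedPair {xs = xs} {R = R} sym tr (add {a} {b} {xs = ys} a≢b ab a∉ b∉ M) N (s≤s k≤l)
  with a ∈? xs | b ∈? xs
... | no a∉xs | no b∉xs = a , b , a≢b , ab , (here refl , a∉xs) , (there (here refl) , b∉xs)
... | no a∉xs | yes b∈xs with splitAt sym b∈xs N
...   | split _ bc _ _ N′ π =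
        contractPath sym tr ab bc a∉ b∉ a∉xs (here refl) (there ∘ there) π
          (unmatchedPair sym tr M N′ k≤l)
unmatchedPair {xs = xs} {R = R} sym tr (add {a} {b} {xs = ys} a≢b ab a∉ b∉ M) N (s≤s k≤l)
    | yes a∈xs | no b∉xs with splitAt sym a∈xs N
...   | split _ ac _ _ N′ π =
        contractPath sym tr (sym ab) ac b∉ a∉ b∉xs (there (here refl)) (there ∘ there) π
          (unmatchedPair sym tr M N′ k≤l)
unmatchedPair {xs = xs} {R = R} sym tr (add {a} {b} {xs = ys} a≢b ab a∉ b∉ M) N (s≤s k≤l)
    | yes a∈xs | yes b∈xs with splitAt sym a∈xs N
...   | split {zs} {b = c} a≢c ac a∉zs c∉zs N′ π = result (∈-resp-↭ π b∈xs)
  where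
  lift : ∀ {us} → (∀ {r} → r ≢ a → r ≢ b → r ∉ us → r ∉ xs) →
         UnmatchedPair R ys us → UnmatchedPair R (a ∷ b ∷ ys) xs
  lift f (p , q , p≢q , pq , (p∈ , p∉) , (q∈ , q∉)) =
    p , q , p≢q , pq ,
    (there (there p∈) , f (λ { refl → a∉ p∈ }) (λ { refl → b∉ p∈ }) p∉) ,
    (there (there q∈) , f (λ { refl → a∉ q∈ }) (λ { refl → b∉ q∈ }) q∉)
  result : b ∈ a ∷ c ∷ zs → UnmatchedPair R (a ∷ b ∷ ys) xs
  result (here b≡a)           = ⊥-elim (a≢b (≡-sym b≡a))
  result (there (here refl))  =
    lift (λ r≢a r≢b r∉ → ∉-∷ r≢a (∉-∷ r≢b r∉) ∘ ∈-resp-↭ π) (unmatchedPair sym tr M N′ k≤l)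
  result (there (there b∈zs)) with splitAt sym b∈zs N′
  -- The edges `a c` and `b d` of the smaller matching are replaced by the single edge `c d`, so
  -- each matching gets smaller by exactly one edge.
  ... | split {ws} {b = d} b≢d bd b∉ws d∉ws N″ ρ =
        lift (λ r≢a r≢b r∉ → ∉-∷ r≢a (∉-∷ (r∉ ∘ here)
                (∉-∷ r≢b (r∉ ∘ there) ∘ ∈-resp-↭ ρ)) ∘ ∈-resp-↭ π)
             (unmatchedPair sym tr M
               (add (λ { refl → c∉zs (back (there (here refl))) }) (tr (sym ac) (tr ab bd))
                    (c∉zs ∘ back ∘ there ∘ there) d∉ws N″) k≤l)
    where
    back : b ∷ d ∷ ws ⊆ zs
    back = ∈-resp-↭ (↭-sym ρ)

-- Missable vertices, Gallai's lemma and stability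

Maximum : Rel (Fin V) 0ℓ → ℕ → Set
Maximum H k = ∀ {xs} → ¬ Match H (suc k) xs

-- For maximum k these vertices form the set D of the Gallai–Edmonds decomposition.
Missable : Rel (Fin V) 0ℓ → ℕ → Pred (Fin V) 0ℓ
Missable H k w = ∃ λ xs → Match H k xs × w ∉ xs

missable? : Decidable₂ H → ∀ k → Decidable (Missable H k)
missable? H? k w = match? H? (λ xs → ¬? (w ∈? xs)) k

missable-mono : (∀ {u v} → H u v → H′ u v) → Missable H k w → Missable H′ k w
missable-mono f (xs , N , w∉) = xs , mapMatch (λ _ _ → f) N , w∉

-- Concluding `x ≡ y` rather than a contradiction makes the relation reflexive, so that transitivity
-- also covers coinciding outer vertices.
Inseparable : Rel (Fin V) 0ℓ → ℕ → Rel (Fin V) 0ℓ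
Inseparable H k x y = ∀ {xs} → Match H k xs → x ∉ xs → y ∉ xs → x ≡ y

-- Gallai's lemma. If `N` misses `x` and `z` but covers `y`, exchange with a matching that misses
-- `y`. By maximality nothing is augmented, so `N` turns into a matching that misses `y` and covers
-- only one new vertex; it still misses `x` or `z`, against one of the hypotheses.
inseparable-trans : ∀ {x y z} → Symmetric H → Maximum H k → Missable H k y →
                    Inseparable H k x y → Inseparable H k y z → Inseparable H k x z
inseparable-trans {x = x} {y} {z} sym max (_ , N′ , y∉ys) xy yz {xs} N x∉xs z∉xs with x ≟ z | y ∈? xs
... | yes x≡z | _        = x≡z
... | no _    | no y∉xs  = trans (xy N x∉xs y∉xs) (yz N y∉xs z∉xs)
... | no x≢z  | yes y∈xs with exchange sym N′ N y∉ys y∈xs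
...   | augment _ _ _ N₁ _ _ _ _ _ = ⊥-elim (max N₁)
...   | slide {x = p} _ N₁ ⊆N y∉ with p ≟ x
...     | yes refl = ⊥-elim (z∉xs (subst (_∈ xs) (yz N₁ y∉ (∉-∷ (≢-sym x≢z) z∉xs ∘ ⊆N)) y∈xs))
...     | no p≢x   =
          ⊥-elim (x∉xs (subst (_∈ xs) (≡-sym (xy N₁ (∉-∷ (≢-sym p≢x) x∉xs ∘ ⊆N) y∉)) y∈xs))

-- The stability lemma of Gallai–Edmonds theory: deleting a vertex outside D with a neighbour in D
-- creates no new missable vertices.
stability : Symmetric H → ¬ Missable H (suc k) a → Missable H (suc k) u → H u a →
            Match H k xs → a ∉ xs → w ∉ xs → w ≢ a → Missable H (suc k) w
stability {a = a} {w = w} sym a∉D (ys , N , u∉ys) ua Q a∉xs w∉xs w≢a with a ∈? ys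
... | no a∉ys  = ⊥-elim (a∉D (ys , N , a∉ys))
... | yes a∈ys with exchange sym Q N a∉xs a∈ys
...   | slide _ N₁ _ a∉                           = ⊥-elim (a∉D (_ , N₁ , a∉))
...   | augment {x = x} x∈ _ _ Q₁ ⊆Q N₁ ⊆N a∉ x∉ with w ≟ x
-- Either `Q₁` still misses `w`, or the path ends at `w`; in that case `N₁` misses `w`, `a` and `u`,
-- and the edge `u a` restores its size.
...     | no w≢x   = _ , Q₁ , ∉-∷ w≢a (∉-∷ w≢x w∉xs) ∘ ⊆Q
...     | yes refl = _ , add (λ { refl → u∉ys a∈ys }) ua (u∉ys ∘ ⊆N) a∉ N₁ ,
                     ∉-∷ (λ { refl → u∉ys x∈ }) (∉-∷ w≢a x∉)

-- Deleting a vertex and adding an edge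

-- The vertex `a` remains as an isolated one, which every matching misses.
_∖_ : Rel (Fin V) 0ℓ → Fin V → Rel (Fin V) 0ℓ
(H ∖ a) x y = H x y × x ≢ a × y ≢ a

∖-sym : Symmetric H → Symmetric (H ∖ a)
∖-sym sym (h , x≢a , y≢a) = sym h , y≢a , x≢a

∖-dec : Decidable₂ H → Decidable₂ (H ∖ a)
∖-dec {a = a} H? x y = H? x y ×-dec ¬? (x ≟ a) ×-dec ¬? (y ≟ a)

restrict : a ∉ xs → Match H k xs → Match (H ∖ a) k xs
restrict a∉ = mapMatch λ { p q h → h , (λ { refl → a∉ p }) , (λ { refl → a∉ q }) }

isolated : (∀ {u v} → H u v → u ≢ a × v ≢ a) → Match H k xs → a ∉ xs
isolated f (add _ h _ _ _) (here refl)         = proj₁ (f h) refl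
isolated f (add _ h _ _ _) (there (here refl)) = proj₂ (f h) refl
isolated f (add _ _ _ _ m) (there (there a∈))  = isolated f m a∈

deleteVertex : Symmetric H → ∀ a → Match H (suc k) xs → ∃ λ ys → Match (H ∖ a) k ys × ys ⊆ xs
deleteVertex {xs = xs} sym a m with a ∈? xs
... | yes a∈ with splitAt sym a∈ m
...   | split _ _ a∉ _ m′ π = _ , restrict a∉ m′ , ∈-resp-↭ (↭-sym π) ∘ there ∘ there
-- When `a` is not covered, an arbitrary edge is dropped to reach size exactly `k`.
deleteVertex sym a (add _ _ _ _ m) | no a∉ = _ , restrict (a∉ ∘ there ∘ there) m , there ∘ there

_+[_,_] : Rel (Fin V) 0ℓ → Fin V → Fin V → Rel (Fin V) 0ℓ
(H +[ u , v ]) x y = H x y ⊎ (x ≡ u × y ≡ v) ⊎ (x ≡ v × y ≡ u)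

+-sym : Symmetric H → Symmetric (H +[ u , v ])
+-sym sym (inj₁ h)                 = inj₁ (sym h)
+-sym sym (inj₂ (inj₁ (p , q))) = inj₂ (inj₂ (q , p))
+-sym sym (inj₂ (inj₂ (p , q))) = inj₂ (inj₁ (q , p))

+-dec : Decidable₂ H → Decidable₂ (H +[ u , v ])
+-dec {u = u} {v} H? x y = H? x y ⊎-dec (x ≟ u ×-dec y ≟ v) ⊎-dec (x ≟ v ×-dec y ≟ u)

-- Growth by one edge of a larger matching

Grows : Rel (Fin V) 0ℓ → ℕ → Rel (Fin V) 0ℓ → Set
Grows H k H′ = (∃ λ xs → Match H′ (suc k) xs) ⊎ (∃ λ w → ¬ Missable H k w × Missable H′ k w)

GrowsBy : Rel (Fin V) 0ℓ → ℕ → Rel (Fin V) 0ℓ → Set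
GrowsBy H k E = ∃₂ λ u v → E u v × Grows H k (H +[ u , v ])

Closed : Rel (Fin V) 0ℓ → ℕ → Set
Closed H k = ∀ {u v} → Missable H k u → H u v → Missable H k v

-- With no edges leaving D, either an edge of E leaves D, or it joins separable vertices of D, or all
-- edges of H and E respect the classes of inseparable vertices, which bounds the matchings of E.
growsBy-closed : Symmetric H → Decidable₂ H → Symmetric E → Decidable₂ E →
                 Maximum H k → Closed H k → Match H k xs → Match E (suc k) ys → GrowsBy H k E
growsBy-closed {H = H} {E = E} {k = k} {xs = xs} sym H? Esym E? max closed N M
  with any? (λ u → any? (λ v → E? u v ×-dec missable? H? k u ×-dec ¬? (missable? H? k v)))
... | yes (u , v , e , (ys , N′ , u∉ys) , v∉D) = leaving (v ∈? ys)
  where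
  leaving : Dec (v ∈ ys) → GrowsBy H k E
  leaving (no v∉ys)  = ⊥-elim (v∉D (ys , N′ , v∉ys))
  leaving (yes v∈ys) with splitAt sym v∈ys N′
  -- Replacing `v w` by the new edge `u v` frees `w`, which lies outside `D` because no edge of `H`
  -- leaves `D`.
  ... | split {zs} {b = w} v≢w vw v∉zs w∉zs N″ π =
        u , v , e , inj₂ (w , (λ w∈D → v∉D (closed w∈D (sym vw))) , u ∷ v ∷ zs ,
          add (λ { refl → u∉ys v∈ys }) (inj₂ (inj₁ (refl , refl))) (u∉ys ∘ back ∘ there ∘ there) v∉zs
              (mapMatch (λ _ _ → inj₁) N″) ,
          ∉-∷ (λ { refl → u∉ys (back (there (here refl))) }) (∉-∷ (≢-sym v≢w) w∉zs))
    where
    back : v ∷ w ∷ zs ⊆ ys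
    back = ∈-resp-↭ (↭-sym π)
... | no noneLeaves
  with any? (λ u → any? (λ v → E? u v ×-dec ¬? (u ≟ v) ×-dec
         match? H? (λ xs → ¬? (u ∈? xs) ×-dec ¬? (v ∈? xs)) k))
...   | yes (u , v , e , u≢v , zs , N′ , u∉ , v∉) =
        u , v , e , inj₁ (_ , add u≢v (inj₂ (inj₁ (refl , refl))) u∉ v∉ (mapMatch (λ _ _ → inj₁) N′))
...   | no noneSeparable = ⊥-elim (absurd (unmatchedPair R-sym R-trans (mapMatch (λ _ _ → E⊆R) M)
                                             (mapMatch (λ _ _ → H⊆R) N) (n<1+n k)))
  where
  D : Pred (Fin _) 0ℓ
  D = Missable H k
  -- All vertices outside `D` may form a single class: `N` covers every one of them, so an unmatched
  -- pair cannot lie there.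
  R : Rel (Fin _) 0ℓ
  R x y = (D x × D y × Inseparable H k x y) ⊎ (¬ D x × ¬ D y)
  R-sym : Symmetric R
  R-sym (inj₁ (x∈D , y∈D , xy)) = inj₁ (y∈D , x∈D , λ N p q → ≡-sym (xy N q p))
  R-sym (inj₂ (x∉D , y∉D))      = inj₂ (y∉D , x∉D)
  R-trans : Transitive R
  R-trans (inj₁ (x∈D , y∈D , xy)) (inj₁ (_ , z∈D , yz)) =
    inj₁ (x∈D , z∈D , inseparable-trans sym max y∈D xy yz)
  R-trans (inj₁ (_ , y∈D , _))    (inj₂ (y∉D , _))      = ⊥-elim (y∉D y∈D)
  R-trans (inj₂ (_ , y∉D))        (inj₁ (y∈D , _))      = ⊥-elim (y∉D y∈D)
  R-trans (inj₂ (x∉D , _))        (inj₂ (_ , z∉D))      = inj₂ (x∉D , z∉D)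
  H⊆R : ∀ {x y} → H x y → R x y
  H⊆R {x} {y} h with missable? H? k x
  ... | no x∉D  = inj₂ (x∉D , λ y∈D → x∉D (closed y∈D (sym h)))
  ... | yes x∈D = inj₁ (x∈D , closed x∈D h , inseparable)
    where
    inseparable : Inseparable H k x y
    inseparable N x∉ y∉ with x ≟ y
    ... | yes x≡y = x≡y
    ... | no x≢y  = ⊥-elim (max (add x≢y h x∉ y∉ N))
  E⊆R : ∀ {x y} → E x y → R x y
  E⊆R {x} {y} e with missable? H? k x | missable? H? k y
  ... | no x∉D  | no y∉D  = inj₂ (x∉D , y∉D)
  ... | yes x∈D | no y∉D  = ⊥-elim (noneLeaves (x , y , e , x∈D , y∉D))
  ... | no x∉D  | yes y∈D = ⊥-elim (noneLeaves (y , x , Esym e , y∈D , x∉D))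
  ... | yes x∈D | yes y∈D = inj₁ (x∈D , y∈D , inseparable)
    where
    inseparable : Inseparable H k x y
    inseparable N x∉ y∉ with x ≟ y
    ... | yes x≡y = x≡y
    ... | no x≢y  = ⊥-elim (noneSeparable (x , y , e , x≢y , _ , N , x∉ , y∉))
  absurd : ¬ UnmatchedPair R _ xs
  absurd (p , q , p≢q , inj₁ (_ , _ , pq) , (_ , p∉) , (_ , q∉)) = p≢q (pq N p∉ q∉)
  absurd (p , q , p≢q , inj₂ (p∉D , _)    , (_ , p∉) , _)        = p∉D (xs , N , p∉)

-- Induction on `k`. Every matching of size `k` covers a vertex `a` outside `D`, so deleting `a`
-- lowers the maximum by one, while `M` loses at most one edge.
growsBy : ∀ k {H E : Rel (Fin V) 0ℓ} → Symmetric H → Decidable₂ H → Symmetric E → Decidable₂ E →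
          Maximum H k → Match H k xs → Match E (suc k) ys → GrowsBy H k E
growsBy k {H} sym H? Esym E? max N M
  with any? (λ u → any? (λ a → H? u a ×-dec missable? H? k u ×-dec ¬? (missable? H? k a)))
... | no none = growsBy-closed sym H? Esym E? max closed N M
  where
  closed : Closed H k
  closed {u} {v} u∈D h with missable? H? k v
  ... | yes v∈D = v∈D
  ... | no v∉D  = ⊥-elim (none (u , v , h , u∈D , v∉D))
growsBy zero sym H? Esym E? max N M | yes (u , a , ua , u∈D , a∉D) = ⊥-elim (a∉D ([] , [] , λ ()))
growsBy (suc k) {H} {E} sym H? Esym E? max N M | yes (u , a , ua , u∈D , a∉D) =
  result (growsBy k (∖-sym sym) (∖-dec H?) (∖-sym Esym) (∖-dec E?) max′
           (proj₁ (proj₂ (deleteVertex sym a N))) (proj₁ (proj₂ (deleteVertex Esym a M))))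
  where
  max′ : Maximum (H ∖ a) k
  max′ N′ = a∉D (_ , mapMatch (λ _ _ → proj₁) N′ , isolated proj₂ N′)
  missable-∖ : ∀ {w} → Missable H (suc k) w → Missable (H ∖ a) k w
  missable-∖ (_ , N′ , w∉) with deleteVertex sym a N′
  ... | _ , N″ , ⊆N = _ , N″ , w∉ ∘ ⊆N
  result : GrowsBy (H ∖ a) k (E ∖ a) → GrowsBy H (suc k) E
  result (p , q , (e , p≢a , q≢a) , growth) = p , q , e , lift growth
    where
    H⁺ : Rel (Fin _) 0ℓ
    H⁺ = H +[ p , q ]
    H⁺? : Decidable₂ H⁺
    H⁺? = +-dec H?
    weaken : ∀ {x y} → ((H ∖ a) +[ p , q ]) x y → H⁺ x y
    weaken = Sum.map₁ proj₁
    avoid : ∀ {x y} → ((H ∖ a) +[ p , q ]) x y → x ≢ a × y ≢ a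
    avoid (inj₁ (_ , avoids))          = avoids
    avoid (inj₂ (inj₁ (refl , refl))) = p≢a , q≢a
    avoid (inj₂ (inj₂ (refl , refl))) = q≢a , p≢a
    lift : Grows (H ∖ a) k ((H ∖ a) +[ p , q ]) → Grows H (suc k) H⁺
    -- A matching of the original maximum size that avoids `a` makes `a` itself missable.
    lift (inj₁ (zs , Q)) = inj₂ (a , a∉D , zs , mapMatch (λ _ _ → weaken) Q , isolated avoid Q)
    lift (inj₂ (w , w∉D′ , zs , Q , w∉zs)) with missable? H⁺? (suc k) a
    ... | yes a∈D⁺ = inj₂ (a , a∉D , a∈D⁺)
    -- Stability is applied after the new edge is added, which is why `a` must still be unmissable
    -- there.
    ... | no a∉D⁺  = inj₂ (w , w∉D′ ∘ missable-∖ ,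
            stability (+-sym sym) a∉D⁺ (missable-mono inj₁ u∈D) (inj₁ ua)
              (mapMatch (λ _ _ → weaken) Q) (isolated avoid Q) w∉zs
              (λ { refl → w∉D′ (zs′ , N′ , isolated proj₂ N′) }))
      where
      zs′ = proj₁ (deleteVertex sym a N)
      N′ = proj₁ (proj₂ (deleteVertex sym a N))

-- Counting

length-match : Match H k xs → length xs ≡ 2 * k
length-match []                          = refl
length-match {k = suc k} (add _ _ _ _ m) =
  cong suc (trans (cong suc (length-match m)) (≡-sym (+-suc k (k + 0))))

∈-─ : ∀ {A : Set} {x y : A} {zs} (p : x ∈ zs) → y ∈ zs → y ≢ x → y ∈ (zs ─ p)
∈-─ (here refl) (here refl) y≢x = ⊥-elim (y≢x refl)
∈-─ (here refl) (there q)   y≢x = q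
∈-─ (there p)   (here refl) y≢x = here refl
∈-─ (there p)   (there q)   y≢x = there (∈-─ p q y≢x)

fresh : ∀ {m} (cs : List (Fin m)) → length cs < m → ∃ λ c → c ∉ cs
fresh cs short with any? (λ c → ¬? (c ∈? cs))
... | yes found = found
... | no none   = ⊥-elim (<⇒≱ short (injective⇒≤ {f = index ∘ member} (index-injective (setoid _) _ _)))
  where
  member : ∀ c → c ∈ cs
  member c with c ∈? cs
  ... | yes c∈ = c∈
  ... | no c∉  = ⊥-elim (none (c , c∉))

-- From graph edges to relations

module _ {G : Graph V} where

  Joins : Edge G → Rel (Fin V) 0ℓ
  Joins e x y = (x ≡ end₁ e × y ≡ end₂ e) ⊎ (x ≡ end₂ e × y ≡ end₁ e)

  joins-sym : ∀ e → Symmetric (Joins e)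
  joins-sym e (inj₁ (p , q)) = inj₂ (q , p)
  joins-sym e (inj₂ (p , q)) = inj₁ (q , p)

  joins? : ∀ e → Decidable₂ (Joins e)
  joins? e x y = (x ≟ end₁ e ×-dec y ≟ end₂ e) ⊎-dec (x ≟ end₂ e ×-dec y ≟ end₁ e)

  joins-∈ : ∀ e {x} → Joins e u v → x ∈ᵥ e → x ∈ u ∷ v ∷ xs
  joins-∈ e (inj₁ (refl , refl)) (inj₁ refl) = here refl
  joins-∈ e (inj₁ (refl , refl)) (inj₂ refl) = there (here refl)
  joins-∈ e (inj₂ (refl , refl)) (inj₁ refl) = there (here refl)
  joins-∈ e (inj₂ (refl , refl)) (inj₂ refl) = here refl

  joins-∉ : ∀ e {x} → Joins e u v → u ∉ xs → v ∉ xs → x ∈ᵥ e → x ∉ xs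
  joins-∉ e (inj₁ (refl , refl)) u∉ v∉ (inj₁ refl) = u∉
  joins-∉ e (inj₁ (refl , refl)) u∉ v∉ (inj₂ refl) = v∉
  joins-∉ e (inj₂ (refl , refl)) u∉ v∉ (inj₁ refl) = v∉
  joins-∉ e (inj₂ (refl , refl)) u∉ v∉ (inj₂ refl) = u∉

  fromDisjoint : ∀ {l} (es : Fin l → Edge G) → PairwiseDisjoint es →
                 ∃ λ xs → Match (λ x y → ∃ λ i → Joins (es i) x y) l xs ×
                          (∀ {x} → x ∈ xs → ∃ λ i → x ∈ᵥ es i)
  fromDisjoint {zero}  es disj = [] , [] , λ ()
  fromDisjoint {suc l} es disj with fromDisjoint (es ∘ suc) (λ i j i≢j → disj (suc i) (suc j) (i≢j ∘ suc-injective))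
  ... | xs , m , cover =
    end₁ e ∷ end₂ e ∷ xs ,
    add loopless (zero , inj₁ (refl , refl)) (uncovered (inj₁ refl)) (uncovered (inj₂ refl))
        (mapMatch (λ { _ _ (i , joins) → suc i , joins }) m) ,
    λ { (here refl)         → zero , inj₁ refl
      ; (there (here refl)) → zero , inj₂ refl
      ; (there (there x∈))  → let i , x∈e = cover x∈ in suc i , x∈e }
    where
    e : Edge G
    e = es zero
    loopless : end₁ e ≢ end₂ e
    loopless eq = irrefl G (subst (Adj G (end₁ e)) (≡-sym eq) (adj e))
    uncovered : ∀ {x} → x ∈ᵥ e → x ∉ xs
    uncovered x∈e x∈xs = let i , x∈eᵢ = cover x∈xs in disj zero (suc i) (λ ()) _ x∈e x∈eᵢ

-- Rainbow matchings

module _ {m n : ℕ} {G : Graph V} (Ms : Fin m → Matching G n) where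

  Pick : Set
  Pick = Fin m × Fin n

  pick : Pick → Edge G
  pick (c , i) = edges (Ms c) i

  Picked : List Pick → Rel (Fin V) 0ℓ
  Picked L x y = Any (λ p → Joins (pick p) x y) L

  picked-sym : ∀ {L} → Symmetric (Picked L)
  picked-sym = Any.map (λ {p} → joins-sym (pick p))

  picked? : ∀ {L} → Decidable₂ (Picked L)
  picked? {L} x y = Any.any? (λ p → joins? (pick p) x y) L

  Colour : Fin m → Rel (Fin V) 0ℓ
  Colour c x y = ∃ λ i → Joins (edges (Ms c) i) x y

  colourMatch : ∀ c {l} → l ≤ n → ∃ λ xs → Match (Colour c) l xs
  colourMatch c l≤n with fromDisjoint (λ i → edges (Ms c) (inject≤ i l≤n))
                          (λ i j i≢j → disjoint (Ms c) _ _ (i≢j ∘ inject≤-injective l≤n l≤n i j))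
  ... | xs , M , _ = xs , mapMatch (λ { _ _ (i , joins) → inject≤ i l≤n , joins }) M

  -- At most one edge per colour, so disjoint picks have distinct colours.
  Functional : List Pick → Set
  Functional L = ∀ {c i j} → (c , i) ∈ L → (c , j) ∈ L → i ≡ j

  functional-∷ : ∀ {L c i} → c ∉ map proj₁ L → Functional L → Functional ((c , i) ∷ L)
  functional-∷ c∉ fun (here refl) (here refl) = refl
  functional-∷ c∉ fun (here refl) (there q)   = ⊥-elim (c∉ (∈-map⁺ proj₁ q))
  functional-∷ c∉ fun (there p)   (here refl) = ⊥-elim (c∉ (∈-map⁺ proj₁ p))
  functional-∷ c∉ fun (there p)   (there q)   = fun p q

  -- Frees the colours that the matching does not use, so that each round starts with exactly `k`
  -- picks.
  usedPicks : ∀ {L} → Match (Picked L) k xs →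
              ∃ λ L′ → length L′ ≡ k × L′ ⊆ L × Match (Picked L′) k xs
  usedPicks [] = [] , refl , (λ ()) , []
  usedPicks (add u≢v uv u∉ v∉ M) with usedPicks M | find uv
  ... | L′ , len , L′⊆ , M′ | p , p∈ , joins =
    p ∷ L′ , cong suc len , (λ { (here refl) → p∈ ; (there q) → L′⊆ q }) ,
    add u≢v (here joins) u∉ v∉ (mapMatch (λ _ _ → there) M′)

  disjointPicks : ∀ {L} → Match (Picked L) k xs →
                  ∃ λ (f : Fin k → Pick) → (∀ i → f i ∈ L) × PairwiseDisjoint (pick ∘ f) ×
                                           (∀ i {x} → x ∈ᵥ pick (f i) → x ∈ xs)
  disjointPicks [] = (λ ()) , (λ ()) , (λ ()) , λ ()
  disjointPicks {L = L} (add {xs = xs} {k = k} u≢v uv u∉ v∉ M) with disjointPicks M | find uv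
  ... | f , f∈ , disj , cover | p , p∈ , joins = g , g∈ , g-disj , λ
        { zero x∈ → joins-∈ (pick p) joins x∈ ; (suc i) x∈ → there (there (cover i x∈)) }
    where
    g : Fin (suc k) → Pick
    g zero    = p
    g (suc i) = f i
    g∈ : ∀ i → g i ∈ L
    g∈ zero    = p∈
    g∈ (suc i) = f∈ i
    g-disj : PairwiseDisjoint (pick ∘ g)
    g-disj zero    zero    i≢j x x∈ x∈′ = i≢j refl
    g-disj zero    (suc j) i≢j x x∈ x∈′ = joins-∉ (pick p) joins u∉ v∉ x∈ (cover j x∈′)
    g-disj (suc i) zero    i≢j x x∈ x∈′ = joins-∉ (pick p) joins u∉ v∉ x∈′ (cover i x∈)
    g-disj (suc i) (suc j) i≢j          = disj i j (i≢j ∘ cong suc)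

  toRainbow : ∀ {L} → Functional L → Match (Picked L) n xs → RainbowMatching Ms n
  toRainbow {L = L} fun M with disjointPicks M
  ... | f , f∈ , disj , _ = pick ∘ f , proj₁ ∘ f , disj , injective , λ j → proj₂ (f j) , inj₁ (refl , refl)
    where
    samePick : ∀ {p q} → p ∈ L → q ∈ L → proj₁ p ≡ proj₁ q → p ≡ q
    samePick p∈ q∈ refl = cong (_ ,_) (fun p∈ q∈)
    injective : ∀ {i j} → proj₁ (f i) ≡ proj₁ (f j) → i ≡ j
    injective {i} {j} eq with i ≟ j
    ... | yes i≡j = i≡j
    -- Equal colours give equal picks, and an edge is not disjoint from itself.
    ... | no i≢j  = ⊥-elim (disj i j i≢j _ (inj₁ refl)
                      (inj₁ (cong (end₁ ∘ pick) (samePick (f∈ i) (f∈ j) eq))))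

  Rainbow : ℕ → Set
  Rainbow k = ∃ λ L → Functional L × ∃ λ xs → Match (Picked L) k xs

  -- Each fresh colour either enlarges the matching or makes a vertex of Y missable.
  enlarge : (∀ {k} → k < n → 3 * k < m) → ∀ t {L Y} → length Y ≡ t → Functional L → k < n →
            Match (Picked L) k xs → (∀ {w} → ¬ Missable (Picked L) k w → w ∈ Y) →
            length L + length Y ≤ 3 * k → Rainbow (suc k)
  enlarge {k = k} enough t {L} {Y} len fun k<n N ¬D⊆Y bound
    with match? (picked? {L}) (λ _ → yes tt) (suc k)
  ... | yes (xs , M , _) = L , fun , xs , M
  ... | no none
    with fresh (map proj₁ L) (subst (_< m) (≡-sym (length-map proj₁ L))
                               (≤-<-trans (≤-trans (m≤m+n _ _) bound) (enough k<n)))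
  ... | c , c∉ with growsBy k picked-sym picked?
                     (λ { (i , joins) → i , joins-sym (edges (Ms c) i) joins })
                     (λ x y → any? (λ i → joins? (edges (Ms c) i) x y))
                     (λ M → none (_ , M , tt)) N (proj₂ (colourMatch c k<n))
  ... | u , v , (i , joins) , growth = result t len growth
    where
    L⁺ : List Pick
    L⁺ = (c , i) ∷ L
    fun⁺ : Functional L⁺
    fun⁺ = functional-∷ c∉ fun
    include : ∀ {x y} → (Picked L +[ u , v ]) x y → Picked L⁺ x y
    include (inj₁ p)                    = there p
    include (inj₂ (inj₁ (refl , refl))) = here joins
    include (inj₂ (inj₂ (refl , refl))) = here (joins-sym (pick (c , i)) joins)
    result : ∀ t → length Y ≡ t → Grows (Picked L) k (Picked L +[ u , v ]) → Rainbow (suc k)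
    result t len (inj₁ (ys , M)) = L⁺ , fun⁺ , ys , mapMatch (λ _ _ → include) M
    result t len (inj₂ (w , w∉D , w∈D⁺)) with length-removeAt′ Y (index (¬D⊆Y w∉D))
    result zero    len (inj₂ (w , w∉D , w∈D⁺)) | eq with () ← trans (≡-sym len) eq
    -- As `L` gains a pick, `w` leaves `Y`, so the sum of the two lengths is unchanged.
    result (suc t) len (inj₂ (w , w∉D , w∈D⁺)) | eq =
      enlarge enough t (cong pred (trans (≡-sym eq) len)) fun⁺ k<n (mapMatch (λ _ _ → there) N)
        (λ w′∉D⁺ → ∈-─ (¬D⊆Y w∉D) (¬D⊆Y (w′∉D⁺ ∘ missable-mono there))
                       (λ { refl → w′∉D⁺ (missable-mono include w∈D⁺) }))
        (subst (_≤ 3 * k) (trans (cong (length L +_) eq) (+-suc _ _)) bound)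

  rainbow : (∀ {k} → k < n → 3 * k < m) → ∀ k → k ≤ n → Rainbow k
  rainbow enough zero    _   = [] , (λ ()) , [] , []
  rainbow enough (suc k) k<n with rainbow enough k (<⇒≤ k<n)
  ... | _ , fun , xs , M with usedPicks M
  ...   | L , len , L⊆ , N =
          -- Initially `Y` is the list of the `2 * k` vertices covered by `N`; with the `k` picks
          -- this gives `3 * k`.
          enlarge enough _ refl (λ p q → fun (L⊆ p) (L⊆ q)) k<n N ¬D⊆xs
            (≤-reflexive (cong₂ _+_ len (length-match N)))
    where
    ¬D⊆xs : ∀ {w} → ¬ Missable (Picked L) k w → w ∈ xs
    ¬D⊆xs {w} w∉D with w ∈? xs
    ... | yes w∈ = w∈
    ... | no w∉  = ⊥-elim (w∉D (xs , N , w∉))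

theorem1p9 : (n : ℕ) → n ≥ 1 → (V : ℕ) → (G : Graph V) →
    (Ms : Fin (3 * n ∸ 2) → Matching G n) →
    RainbowMatching Ms n
theorem1p9 (suc n) _ V G Ms with rainbow Ms enough (suc n) ≤-refl
  where
  enough : ∀ {k} → k < suc n → 3 * k < 3 * suc n ∸ 2
  -- `3 * suc n ∸ 2` equals `3 * n + 1`, which is just enough for the last round `k = n`.
  enough {k} (s≤s k≤n) = subst (λ l → 3 * k < l ∸ 2) (≡-sym (*-suc 3 n)) (s≤s (*-monoʳ-≤ 3 k≤n))
... | _ , fun , _ , M = toRainbow Ms fun M
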